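{- There is an absolute constant $C$ such that if $F$ is a graph with $n$ vertices and $m\ge\sqrt{n}$ edges, then $\mathrm{cp}(\overline{F})\le C(mn)^{2/3}$; that is, $\mathrm{cp}(\overline{F})=O((mn)^{2/3})$.
   Context: A clique partition of a graph $G$ is a collection of complete subgraphs of $G$ whose edge sets partition $E(G)$; the clique partition number $\mathrm{cp}(G)$ is the minimum number of cliques in a clique partition of $G$. $\overline{F}$ denotes the complement of the graph $F$ (on the same vertex set). -}

module Defs where

open import Data.Nat using (ℕ; _<ᵇ_)
open import Data.Fin using (Fin; toℕ; _≟_)
open import Data.Fin.Subset using (Subset)
open import Data.Bool using (Bool; true; false; not; _∧_; if_then_else_)
open import Data.Bool.Properties using (not-involutive)
open import Data.Vec using (lookup)
open import Data.List using (List; length; filterᵇ; cartesianProduct; allFin)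
open import Data.List.Relation.Unary.All using (All)
open import Data.Product using (_×_; proj₁; proj₂)
open import Relation.Nullary using (¬_; yes; no)
open import Relation.Nullary.Decidable using (⌊_⌋)
open import Relation.Binary.PropositionalEquality using (_≡_; refl; sym; cong)

record Graph (n : ℕ) : Set where
  field
    adj    : Fin n → Fin n → Bool
    adjSym : ∀ i j → adj i j ≡ adj j i
    adjIrr : ∀ i → adj i i ≡ false
open Graph public

compAdj : ∀ {n} → Graph n → Fin n → Fin n → Bool
compAdj G i j with i ≟ j
... | yes _ = false
... | no  _ = not (adj G i j)

compSym : ∀ {n} (G : Graph n) i j → compAdj G i j ≡ compAdj G j i
compSym G i j with i ≟ j | j ≟ i
... | yes _ | yes _ = refl
... | yes p | no ¬q = Data.Empty.⊥-elim (¬q (sym p))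
  where import Data.Empty
... | no ¬p | yes q = Data.Empty.⊥-elim (¬p (sym q))
  where import Data.Empty
... | no _  | no _  = cong not (adjSym G i j)

compIrr : ∀ {n} (G : Graph n) i → compAdj G i i ≡ false
compIrr G i with i ≟ i
... | yes _ = refl
... | no ¬p = Data.Empty.⊥-elim (¬p refl)
  where import Data.Empty

complement : ∀ {n} → Graph n → Graph n
complement G = record { adj = compAdj G ; adjSym = compSym G ; adjIrr = compIrr G }

edgeList : ∀ {n} → Graph n → List (Fin n × Fin n)
edgeList {n} G = filterᵇ (λ p → (toℕ (proj₁ p) <ᵇ toℕ (proj₂ p)) ∧ adj G (proj₁ p) (proj₂ p))
                         (cartesianProduct (allFin n) (allFin n))

edgeCount : ∀ {n} → Graph n → ℕ
edgeCount G = length (edgeList G)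

IsClique : ∀ {n} → Graph n → Subset n → Set
IsClique G S = ∀ i j → lookup S i ≡ true → lookup S j ≡ true → ¬ (i ≡ j) → adj G i j ≡ true

countContaining : ∀ {n} → List (Subset n) → Fin n → Fin n → ℕ
countContaining Cs i j = length (filterᵇ (λ S → lookup S i ∧ lookup S j) Cs)

IsCliquePartition : ∀ {n} → Graph n → List (Subset n) → Set
IsCliquePartition G Cs =
  All (IsClique G) Cs ×
  (∀ i j → ¬ (i ≡ j) → adj G i j ≡ true → countContaining Cs i j ≡ 1)

{-# OPTIONS --safe #-}
module Submission where

-- Suppose the complete graph on the vertices of F is partitioned into b cliques ("blocks") with at most K vertices
-- each. Remove from every block the smaller endpoint of each edge of F inside the block, and take every pair that a
-- removed vertex formed in its block, edges of F excepted, as a 2-clique. This partitions the complement of F into at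
-- most b + 2mK cliques.
--
-- For a prime q with q² > n, placing vertex c q + x at the point (x, x² + c) puts the vertices on at most n/q + 1
-- parabolas of the affine plane over ℤ/q. A line meets each parabola in at most two points, so the q² + q lines are
-- blocks with K ≤ 2(n/q + 1). Taking q³ between mn and a constant multiple of it balances q² against mn/q.
--
-- Such a prime exists by a weak form of Bertrand's postulate. If no prime lies in (y, 8y] with 8y = s², s = 2ᵗ, then
-- every number up to 8y divides D = (∏_{p ≤ y} p) (s!)²ᵗ, hence so does 4y (8y choose 4y); but D < 2⁴ʸ for t ≥ 10.

open import Defs
open import Data.Nat
open import Data.Nat.Properties
open import Algebra.Properties.CommutativeSemigroup *-commutativeSemigroup using (x∙yz≈y∙xz)
open import Data.Nat.Coprimality as Coprimality using (Coprime; coprime-divisor; coprime-Bézout)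
open import Data.Nat.DivMod
open import Data.Nat.Divisibility
open import Data.Nat.GCD using (module Bézout)
open import Data.Nat.ListAction using (product)
open import Data.Nat.Primality
open import Data.Nat.Primality.Factorisation using (factorise; PrimeFactorisation)
open import Data.Nat.Tactic.RingSolver using (solve-∀)
open import Data.Integer as ℤ using (ℤ; +_; -[1+_])
import Data.Integer.DivMod as ℤ
import Data.Integer.Properties as ℤ
import Data.Integer.Tactic.RingSolver as ℤ
import Data.Integer.Divisibility.Signed as Signed
open Signed using () renaming (_∣_ to infix 4 _∣ℤ_)
open import Data.Bool using (Bool; true; false; T; not)
open import Data.Bool.Properties using (T?; T-≡; T-∧)
import Data.Bool.Properties as Bool
open import Data.Fin as Fin using (Fin; toℕ; fromℕ<)
open import Data.Fin.Properties using (any?; toℕ-injective; toℕ<n; toℕ-fromℕ<)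
open import Data.Fin.Subset using (Subset)
open import Data.Vec using (lookup; tabulate)
open import Data.Vec.Properties using (lookup∘tabulate)
open import Data.List using (List; []; _∷_; _++_; length; map; filter; filterᵇ; concatMap; cartesianProduct; allFin; upTo)
open import Data.List.Properties using (length-++; length-map; length-filter; length-upTo; filter-some; length-tabulate)
open import Data.List.Membership.Propositional using (_∈_; lose)
open import Data.List.Membership.Propositional.Properties
open import Data.List.Relation.Unary.All as All using (All; []; _∷_)
import Data.List.Relation.Unary.All.Properties as All
open import Data.List.Relation.Unary.AllPairs using (_∷_)
open import Data.List.Relation.Unary.Any using (here; there)
open import Data.List.Relation.Unary.Unique.Propositional using (Unique)
import Data.List.Relation.Unary.Unique.Propositional.Properties as Unique
open import Data.Product using (Σ; ∃-syntax; _×_; _,_; proj₁; proj₂)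
open import Data.Sum using (_⊎_; inj₁; inj₂; [_,_]; [_,_]′)
open import Data.Sum.Properties using (inj₁-injective; inj₂-injective)
open import Data.Empty using (⊥; ⊥-elim)
open import Function using (_∘_; id; Equivalence)
open import Relation.Nullary
open import Relation.Nullary.Decidable using (_×-dec_; _⊎-dec_; ¬?; dec-true)
open import Relation.Nullary.Reflects using (invert)
open import Relation.Binary.Definitions using (tri<; tri≈; tri>)
open import Relation.Binary.PropositionalEquality hiding ([_])

-- Binomial coefficients and primes

-- Indexing by the two parts, binomial i j = (i + j) C i, makes Pascal's rule and the factorial formula free of
-- truncated subtraction.
binomial : ℕ → ℕ → ℕ
binomial zero    j       = 1
binomial (suc i) zero    = 1
binomial (suc i) (suc j) = binomial i (suc j) + binomial (suc i) j

binomial-factorial : ∀ i j → binomial i j * (i ! * j !) ≡ (i + j) !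
binomial-factorial zero    j = trans (+-identityʳ _) (+-identityʳ _)
binomial-factorial (suc i) zero = trans (+-identityʳ _) (trans (*-identityʳ _) (cong (λ k → suc k !) (sym (+-identityʳ i))))
binomial-factorial (suc i) (suc j) = begin
  (a + b) * (suc i ! * suc j !)
    ≡⟨ regroup a b i (i !) j (j !) ⟩
  suc i * (a * (i ! * suc j !)) + suc j * (b * (suc i ! * j !))
    ≡⟨ cong₂ _+_ (cong (suc i *_) (trans (binomial-factorial i (suc j)) (cong _! (+-suc i j))))
                 (cong (suc j *_) (binomial-factorial (suc i) j)) ⟩
  suc i * (suc i + j) ! + suc j * (suc i + j) !
    ≡⟨ *-distribʳ-+ ((suc i + j) !) (suc i) (suc j) ⟨
  (suc i + suc j) * (suc i + j) !
    ≡⟨ cong (λ k → suc k * (suc i + j) !) (+-suc i j) ⟩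
  suc (suc i + j) * (suc i + j) !
    ≡⟨ cong _! (+-suc (suc i) j) ⟨
  (suc i + suc j) ! ∎
  where
  open ≡-Reasoning
  a = binomial i (suc j)
  b = binomial (suc i) j
  regroup : ∀ a b i x j y →
    (a + b) * ((x + i * x) * (y + j * y)) ≡ suc i * (a * (x * (y + j * y))) + suc j * (b * ((x + i * x) * y))
  regroup = solve-∀

binomial≢0 : ∀ i j → NonZero (binomial i j)
binomial≢0 zero    j       = _
binomial≢0 (suc i) zero    = _
binomial≢0 (suc i) (suc j) with binomial i (suc j) | binomial≢0 i (suc j)
... | suc _ | _ = _

binomial-upper : ∀ i j → binomial i j ≤ 2 ^ (i + j)
binomial-upper zero    j    = m^n>0 2 j
binomial-upper (suc i) zero = m^n>0 2 (suc i + 0)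
binomial-upper (suc i) (suc j) = begin
  binomial i (suc j) + binomial (suc i) j ≤⟨ +-mono-≤ (binomial-upper i (suc j)) (binomial-upper (suc i) j) ⟩
  2 ^ (i + suc j) + 2 ^ (suc i + j)       ≡⟨ cong (λ k → 2 ^ (i + suc j) + 2 ^ k) (+-suc i j) ⟨
  2 ^ (i + suc j) + 2 ^ (i + suc j)       ≡⟨ cong (λ k → 2 ^ (i + suc j) + k) (+-identityʳ _) ⟨
  2 ^ (suc i + suc j)                     ∎
  where open ≤-Reasoning

binomial-suc-left : ∀ i j → binomial i j ≤ binomial (suc i) j
binomial-suc-left zero    zero    = ≤-refl
binomial-suc-left zero    (suc j) = m≤m+n 1 _
binomial-suc-left (suc i) zero    = ≤-refl
binomial-suc-left (suc i) (suc j) = m≤m+n _ _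

binomial-suc-right : ∀ i j → binomial i j ≤ binomial i (suc j)
binomial-suc-right zero    j = ≤-refl
binomial-suc-right (suc i) j = m≤n+m _ _

-- Both Pascal summands of the next central coefficient are at least the current one, so it at least
-- doubles. Base 2 rather than 4 is enough to exceed `D-upper`.
central-binomial-lower : ∀ m → 2 ^ m ≤ binomial m m
central-binomial-lower zero    = ≤-refl
central-binomial-lower (suc m) = begin
  2 ^ m + (2 ^ m + 0)                     ≡⟨ cong (λ k → 2 ^ m + k) (+-identityʳ _) ⟩
  2 ^ m + 2 ^ m                           ≤⟨ +-mono-≤ (≤-trans ih (binomial-suc-right m m)) (≤-trans ih (binomial-suc-left m m)) ⟩
  binomial m (suc m) + binomial (suc m) m ∎
  where
  open ≤-Reasoning
  ih = central-binomial-lower m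

-- Multiplied by `i ! * j !`, both sides become the factorial of `suc (i + j)`; the same holds for
-- `absorb-left`.
absorb-right : ∀ i j → suc j * binomial i (suc j) ≡ suc (i + j) * binomial i j
absorb-right i j = *-cancelʳ-≡ _ _ (i ! * j !) {{i !* j !≢0}} (begin
  suc j * binomial i (suc j) * (i ! * j !)  ≡⟨ regroup (suc j) (binomial i (suc j)) (i !) (j !) ⟩
  binomial i (suc j) * (i ! * suc j !)      ≡⟨ binomial-factorial i (suc j) ⟩
  (i + suc j) !                             ≡⟨ cong _! (+-suc i j) ⟩
  suc (i + j) * (i + j) !                   ≡⟨ cong (suc (i + j) *_) (binomial-factorial i j) ⟨
  suc (i + j) * (binomial i j * (i ! * j !)) ≡⟨ *-assoc (suc (i + j)) (binomial i j) (i ! * j !) ⟨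
  suc (i + j) * binomial i j * (i ! * j !)  ∎)
  where
  open ≡-Reasoning
  regroup : ∀ s b x y → s * b * (x * y) ≡ b * (x * (s * y))
  regroup = solve-∀

absorb-left : ∀ i j → suc i * binomial (suc i) j ≡ suc (i + j) * binomial i j
absorb-left i j = *-cancelʳ-≡ _ _ (i ! * j !) {{i !* j !≢0}} (begin
  suc i * binomial (suc i) j * (i ! * j !)   ≡⟨ regroup (suc i) (binomial (suc i) j) (i !) (j !) ⟩
  binomial (suc i) j * (suc i ! * j !)       ≡⟨ binomial-factorial (suc i) j ⟩
  suc (i + j) * (i + j) !                    ≡⟨ cong (suc (i + j) *_) (binomial-factorial i j) ⟨
  suc (i + j) * (binomial i j * (i ! * j !)) ≡⟨ *-assoc (suc (i + j)) (binomial i j) (i ! * j !) ⟨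
  suc (i + j) * binomial i j * (i ! * j !)   ∎)
  where
  open ≡-Reasoning
  regroup : ∀ s b x y → s * b * (x * y) ≡ b * (s * x * y)
  regroup = solve-∀

-- Leibniz's harmonic triangle: 1/c(i, j+1) = 1/c(i, j) − 1/c(i+1, j) for c(i, j) = (i+1) binomial (i+1) j.
leibniz-triangle : ∀ D N → (∀ k → 0 < k → k ≤ N → k ∣ D) →
                   ∀ j i → suc i + j ≤ N → suc i * binomial (suc i) j ∣ D
leibniz-triangle D N all zero i le =
  subst (_∣ D) (sym (*-identityʳ (suc i))) (all (suc i) z<s (≤-trans (m≤m+n _ 0) le))
leibniz-triangle D N all (suc j) i le
  with leibniz-triangle D N all j i (≤-trans (+-monoʳ-≤ (suc i) (n≤1+n j)) le)
     | leibniz-triangle D N all j (suc i) (subst (_≤ N) (+-suc (suc i) j) le)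
-- Here `t` is D/c(i, j) and `u` is D/c(i+1, j), so their difference is D/c(i, j+1). Multiplication
-- distributes over `∸` even under truncation, hence `t` and `u` need no comparison.
... | divides t D≡t*c | divides u D≡u*c = divides (t ∸ u) (*-cancelˡ-≡ _ _ (suc j) (begin
  suc j * D                                       ≡⟨ cong (_* D) (m+n∸m≡n (suc i) (suc j)) ⟨
  (suc i + suc j ∸ suc i) * D                     ≡⟨ *-distribʳ-∸ D (suc i + suc j) (suc i) ⟩
  (suc i + suc j) * D ∸ suc i * D                 ≡⟨ cong₂ (λ x y → (suc i + suc j) * x ∸ suc i * y) D≡t*c D≡u*c ⟩
  (suc i + suc j) * (t * c₀) ∸ suc i * (u * c₁)   ≡⟨ cong₂ _∸_ (x∙yz≈y∙xz (suc i + suc j) t c₀) (x∙yz≈y∙xz (suc i) u c₁) ⟩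
  t * ((suc i + suc j) * c₀) ∸ u * (suc i * c₁)   ≡⟨ cong₂ (λ x y → t * x ∸ u * y) step₀ step₁ ⟩
  t * (suc j * c) ∸ u * (suc j * c)               ≡⟨ *-distribʳ-∸ (suc j * c) t u ⟨
  (t ∸ u) * (suc j * c)                           ≡⟨ x∙yz≈y∙xz (t ∸ u) (suc j) c ⟩
  suc j * ((t ∸ u) * c)                           ∎))
  where
  open ≡-Reasoning
  c₀ = suc i * binomial (suc i) j
  c₁ = suc (suc i) * binomial (suc (suc i)) j
  c  = suc i * binomial (suc i) (suc j)
  step₀ : (suc i + suc j) * c₀ ≡ suc j * c
  step₀ = begin
    (suc i + suc j) * c₀                             ≡⟨ x∙yz≈y∙xz (suc i + suc j) (suc i) _ ⟩
    suc i * ((suc i + suc j) * binomial (suc i) j)   ≡⟨ cong (λ k → suc i * (k * binomial (suc i) j)) (+-suc (suc i) j) ⟩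
    suc i * (suc (suc i + j) * binomial (suc i) j)   ≡⟨ cong (suc i *_) (absorb-right (suc i) j) ⟨
    suc i * (suc j * binomial (suc i) (suc j))       ≡⟨ x∙yz≈y∙xz (suc i) (suc j) _ ⟩
    suc j * c                                        ∎
  step₁ : suc i * c₁ ≡ suc j * c
  step₁ = begin
    suc i * c₁                                       ≡⟨ cong (suc i *_) (absorb-left (suc i) j) ⟩
    suc i * (suc (suc i + j) * binomial (suc i) j)   ≡⟨ cong (suc i *_) (absorb-right (suc i) j) ⟨
    suc i * (suc j * binomial (suc i) (suc j))       ≡⟨ x∙yz≈y∙xz (suc i) (suc j) _ ⟩
    suc j * c                                        ∎

-- Products of primes

primeOr1 : ℕ → ℕ
primeOr1 n with prime? n
... | yes _ = n
... | no  _ = 1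

primeOr1≢0 : ∀ n → NonZero (primeOr1 n)
primeOr1≢0 n with prime? n
... | yes pr = prime⇒nonZero pr
... | no  _  = _

primeOr1-prime : ∀ {p} → Prime p → primeOr1 p ≡ p
primeOr1-prime {p} pr with prime? p
... | yes _  = refl
... | no ¬pr = ⊥-elim (¬pr pr)

prime∣primeOr1⇒≤ : ∀ {p} n → Prime p → p ∣ primeOr1 n → p ≤ n
prime∣primeOr1⇒≤ n pr d with prime? n
... | yes q = ∣⇒≤ {{prime⇒nonZero q}} d
... | no  _ = ⊥-elim (¬prime[1] (subst Prime (∣1⇒≡1 d) pr))

-- The primes in (m, m + j].
primeProduct : ℕ → ℕ → ℕ
primeProduct m zero    = 1
primeProduct m (suc j) = primeOr1 (m + suc j) * primeProduct m j

primeProduct-+ : ∀ m i j → primeProduct m (i + j) ≡ primeProduct m i * primeProduct (m + i) j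
primeProduct-+ m i zero = trans (cong (primeProduct m) (+-identityʳ i)) (sym (*-identityʳ _))
primeProduct-+ m i (suc j) = begin
  primeProduct m (i + suc j)                                        ≡⟨ cong (primeProduct m) (+-suc i j) ⟩
  primeOr1 (m + suc (i + j)) * primeProduct m (i + j)               ≡⟨ cong₂ (λ k l → primeOr1 k * l)
                                                                         (trans (cong (λ k → m + k) (sym (+-suc i j))) (sym (+-assoc m i (suc j))))
                                                                         (primeProduct-+ m i j) ⟩
  primeOr1 (m + i + suc j) * (primeProduct m i * primeProduct (m + i) j)
    ≡⟨ x∙yz≈y∙xz (primeOr1 (m + i + suc j)) (primeProduct m i) _ ⟩
  primeProduct m i * primeProduct (m + i) (suc j)                   ∎
  where open ≡-Reasoning

prime∣primeProduct⇒≤ : ∀ {p} m j → Prime p → p ∣ primeProduct m j → p ≤ m + j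
prime∣primeProduct⇒≤ m zero pr d = ⊥-elim (¬prime[1] (subst Prime (∣1⇒≡1 d) pr))
prime∣primeProduct⇒≤ m (suc j) pr d with euclidsLemma (primeOr1 (m + suc j)) (primeProduct m j) pr d
... | inj₁ e = prime∣primeOr1⇒≤ (m + suc j) pr e
... | inj₂ e = ≤-trans (prime∣primeProduct⇒≤ m j pr e) (+-monoʳ-≤ m (n≤1+n j))

prime∣primeProduct : ∀ {p} m j → Prime p → m < p → p ≤ m + j → p ∣ primeProduct m j
prime∣primeProduct m zero pr m<p p≤ = ⊥-elim (<⇒≱ m<p (subst (_ ≤_) (+-identityʳ m) p≤))
prime∣primeProduct {p} m (suc j) pr m<p p≤ with p ≟ m + suc j
... | yes refl = ∣m⇒∣m*n _ (∣-reflexive (sym (primeOr1-prime pr)))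
... | no p≢    = ∣n⇒∣m*n (primeOr1 (m + suc j))
                   (prime∣primeProduct m j pr m<p (s≤s⁻¹ (subst (p <_) (+-suc m j) (≤∧≢⇒< p≤ p≢))))

primeProduct≢0 : ∀ m j → NonZero (primeProduct m j)
primeProduct≢0 m zero    = _
primeProduct≢0 m (suc j) = m*n≢0 _ _ {{primeOr1≢0 (m + suc j)}} {{primeProduct≢0 m j}}

prime∤⇒coprime : ∀ {p n} → Prime p → p ∤ n → Coprime p n
prime∤⇒coprime pr p∤n (d∣p , d∣n) with prime⇒irreducible pr d∣p
... | inj₁ d≡1  = d≡1
... | inj₂ refl = ⊥-elim (p∤n d∣n)

coprime-*-∣ : ∀ {m n k} → Coprime m n → m ∣ k → n ∣ k → m * n ∣ k
coprime-*-∣ {m} {n} c (divides q refl) n∣k = subst (_∣ q * m) (*-comm n m)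
  (*-monoˡ-∣ m (coprime-divisor (Coprimality.sym c) (subst (n ∣_) (*-comm q m) n∣k)))

prime∣!⇒≤ : ∀ {p} n → Prime p → p ∣ n ! → p ≤ n
prime∣!⇒≤ zero pr p∣ = ⊥-elim (¬prime[1] (subst Prime (∣1⇒≡1 p∣) pr))
prime∣!⇒≤ (suc n) pr p∣ with euclidsLemma (suc n) (n !) pr p∣
... | inj₁ d = ∣⇒≤ d
... | inj₂ d = m≤n⇒m≤1+n (prime∣!⇒≤ n pr d)

∣! : ∀ {k n} → 0 < k → k ≤ n → k ∣ n !
∣! {suc k} _ k≤n = ∣-trans (m∣m*n (k !)) (m≤n⇒m!∣n! k≤n)

-- A prime in (m, 2m] divides (2m)! but not m!, so Euclid's lemma places it in the binomial
-- coefficient. Each new prime exceeds all the earlier ones and is therefore coprime to their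
-- product.
primeProduct∣central-binomial : ∀ m j → j ≤ m → primeProduct m j ∣ binomial m m
primeProduct∣central-binomial m zero    _   = 1∣ _
primeProduct∣central-binomial m (suc j) j<m with prime? (m + suc j)
... | no _  = subst (_∣ binomial m m) (sym (*-identityˡ _)) (primeProduct∣central-binomial m j (<⇒≤ j<m))
... | yes q = coprime-*-∣ (prime∤⇒coprime q p∤P) p∣B (primeProduct∣central-binomial m j (<⇒≤ j<m))
  where
  p = m + suc j
  p≰m : ¬ p ≤ m
  p≰m = <⇒≱ (m<m+n m z<s)
  p∤P : p ∤ primeProduct m j
  p∤P d = <⇒≱ (+-monoʳ-< m (n<1+n j)) (prime∣primeProduct⇒≤ m j q d)
  p∣B : p ∣ binomial m m
  p∣B with euclidsLemma (binomial m m) (m ! * m !) q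
             (subst (p ∣_) (sym (binomial-factorial m m)) (∣! (≤-trans z<s (m≤n+m (suc j) m)) (+-monoʳ-≤ m j<m)))
  ... | inj₁ d = d
  ... | inj₂ d with euclidsLemma (m !) (m !) q d
  ...   | inj₁ e = ⊥-elim (p≰m (prime∣!⇒≤ m q e))
  ...   | inj₂ e = ⊥-elim (p≰m (prime∣!⇒≤ m q e))

n+n≡2*n : ∀ n → n + n ≡ 2 * n
n+n≡2*n n = cong (λ k → n + k) (sym (+-identityʳ n))

-- The bound 4ʸ at powers of two. Passing from y to 2y multiplies the left side by the primes in (y,
-- 2y], whose product divides the central binomial coefficient and is thus at most 2²ʸ.
primorial-upper : ∀ k → primeProduct 0 (2 ^ k) ≤ 2 ^ (2 * 2 ^ k)
primorial-upper zero    = s≤s z≤n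
primorial-upper (suc k) = begin
  primeProduct 0 (2 * y)              ≡⟨ cong (primeProduct 0) (n+n≡2*n y) ⟨
  primeProduct 0 (y + y)              ≡⟨ primeProduct-+ 0 y y ⟩
  primeProduct 0 y * primeProduct y y ≤⟨ *-mono-≤ (primorial-upper k)
      (≤-trans (∣⇒≤ {{binomial≢0 y y}} (primeProduct∣central-binomial y y ≤-refl)) (binomial-upper y y)) ⟩
  2 ^ (2 * y) * 2 ^ (y + y)           ≡⟨ ^-distribˡ-+-* 2 (2 * y) (y + y) ⟨
  2 ^ (2 * y + (y + y))               ≡⟨ cong (2 ^_) (cong (λ k → 2 * y + k) (n+n≡2*n y)) ⟩
  2 ^ (2 * y + 2 * y)                 ≡⟨ cong (2 ^_) (n+n≡2*n (2 * y)) ⟩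
  2 ^ (2 * (2 * y))                   ∎
  where
  open ≤-Reasoning
  y = 2 ^ k

prime-divisor : ∀ n → 1 < n → ∃[ p ] Prime p × p ∣ n
prime-divisor n 1<n = go factors isFactorisation factorsPrime
  where
  open PrimeFactorisation (factorise n {{>-nonZero (<⇒≤ 1<n)}})
  go : ∀ ps → n ≡ product ps → All Prime ps → ∃[ p ] Prime p × p ∣ n
  go [] n≡1 [] = ⊥-elim (<⇒≢ 1<n (sym n≡1))
  go (p ∷ ps) n≡ (pr ∷ _) = p , pr , subst (p ∣_) (sym n≡) (m∣m*n (product ps))

-- A number up to s² has at most one prime factor above s; the others, at most e of them, each divide s !.
∣primeProduct*s!^e : ∀ s y → (∀ p → Prime p → p ≤ s * s → p ≤ y) →
                     ∀ e k → 0 < k → k ≤ 2 ^ e → k ≤ s * s → k ∣ primeProduct 0 y * (s !) ^ e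
∣primeProduct*s!^e s y gap zero    k 0<k k≤1 _ = subst (_∣ _) (≤-antisym 0<k k≤1) (1∣ _)
∣primeProduct*s!^e s y gap (suc e) k 0<k k≤2^ k≤s² with k ≤? 1
... | yes k≤1 = subst (_∣ _) (≤-antisym 0<k k≤1) (1∣ _)
... | no k≰1 with prime-divisor k (≰⇒> k≰1)
...   | p , pr , divides q refl with p ≤? s
...     | yes p≤s = subst (q * p ∣_) (regroup (primeProduct 0 y) ((s !) ^ e) (s !))
                      (*-pres-∣ (∣primeProduct*s!^e s y gap e q 0<q q≤2^e q≤s²) (∣! (<-trans z<s (nonTrivial⇒n>1 p {{prime⇒nonTrivial pr}})) p≤s))
  where
  regroup : ∀ a b c → a * b * c ≡ a * (c * b)
  regroup = solve-∀
  0<q : 0 < q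
  0<q = n≢0⇒n>0 (λ { refl → <-irrefl refl 0<k })
  q≤2^e : q ≤ 2 ^ e
  q≤2^e = *-cancelˡ-≤ 2 (≤-trans (≤-reflexive (*-comm 2 q)) (≤-trans (*-monoʳ-≤ q (nonTrivial⇒n>1 p {{prime⇒nonTrivial pr}})) k≤2^))
  q≤s² : q ≤ s * s
  q≤s² = ≤-trans (m≤m*n q p {{prime⇒nonZero pr}}) k≤s²
-- Since p > s and q p ≤ s², the cofactor q is at most s: a single `s !` absorbs it whole, and
-- `primeProduct 0 y` absorbs p.
...     | no p≰s = subst (_∣ primeProduct 0 y * (s !) ^ suc e) (*-comm p q)
                     (*-pres-∣ p∣P (∣m⇒∣m*n ((s !) ^ e) (∣! 0<q (≮⇒≥ q≯s))))
  where
  0<q : 0 < q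
  0<q = n≢0⇒n>0 (λ { refl → <-irrefl refl 0<k })
  p∣P : p ∣ primeProduct 0 y
  p∣P = prime∣primeProduct 0 y pr (<-trans z<s (nonTrivial⇒n>1 p {{prime⇒nonTrivial pr}}))
          (gap p pr (≤-trans (m≤n*m p q {{>-nonZero 0<q}}) k≤s²))
  q≯s : ¬ s < q
  q≯s s<q = <⇒≱ (*-mono-< s<q (≰⇒> p≰s)) k≤s²

-- A prime between y and 8y

!≤^ : ∀ s → s ! ≤ s ^ s
!≤^ zero    = ≤-refl
!≤^ (suc s) = *-monoʳ-≤ (suc s) (≤-trans (!≤^ s) (^-monoˡ-≤ s (n≤1+n s)))

-- With t = 10 + w this is t² < 2^(t - 3), the source of the threshold t ≥ 10: at t = 9 it would
-- read 81 < 64.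
square<2^ : ∀ w → (10 + w) * (10 + w) < 2 ^ (7 + w)
square<2^ zero = <ᵇ⇒< 100 128 _
square<2^ (suc w) = begin-strict
  (11 + w) * (11 + w)                             ≤⟨ m≤m+n _ (w * w + 18 * w + 79) ⟩
  (11 + w) * (11 + w) + (w * w + 18 * w + 79)     ≡⟨ regroup w ⟩
  2 * ((10 + w) * (10 + w))                       <⟨ *-monoʳ-< 2 (square<2^ w) ⟩
  2 * 2 ^ (7 + w)                                 ≡⟨⟩
  2 ^ (7 + suc w)                                 ∎
  where
  open ≤-Reasoning
  regroup : ∀ w → (11 + w) * (11 + w) + (w * w + 18 * w + 79) ≡ 2 * ((10 + w) * (10 + w))
  regroup = solve-∀

module _ (w : ℕ) where
  private
    t = 10 + w
    s = 2 ^ t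
    -- The exponent `7 + w` is t - 3, which makes y = s²/8.
    y = 2 ^ (7 + w) * s
    -- As s² = 2²ᵗ, a number up to s² has at most 2t prime factors.
    D = primeProduct 0 y * (s !) ^ (2 * t)

  -- The prime product contributes the exponent 2y. The factorials contribute at most 2t²s, because
  -- s! ≤ sˢ and s = 2ᵗ, and t² < 2^(t - 3) makes this less than 2y.
  D-upper : D < 2 ^ (4 * y)
  D-upper = begin-strict
    primeProduct 0 y * (s !) ^ (2 * t)         ≡⟨ cong (λ k → primeProduct 0 k * (s !) ^ (2 * t)) y≡ ⟨
    primeProduct 0 (2 ^ (7 + w + t)) * (s !) ^ (2 * t)
      ≤⟨ *-mono-≤ (primorial-upper (7 + w + t)) (^-monoˡ-≤ (2 * t) (!≤^ s)) ⟩
    2 ^ (2 * 2 ^ (7 + w + t)) * (s ^ s) ^ (2 * t) ≡⟨ cong₂ (λ k l → 2 ^ (2 * k) * l) y≡ s^≡ ⟩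
    2 ^ (2 * y) * 2 ^ (t * (s * (2 * t)))      ≡⟨ ^-distribˡ-+-* 2 (2 * y) _ ⟨
    2 ^ (2 * y + t * (s * (2 * t)))            <⟨ ^-monoʳ-< 2 (s≤s (s≤s z≤n)) exponent ⟩
    2 ^ (4 * y)                                ∎
    where
    open ≤-Reasoning
    y≡ : 2 ^ (7 + w + t) ≡ y
    y≡ = ^-distribˡ-+-* 2 (7 + w) t
    s^≡ : (s ^ s) ^ (2 * t) ≡ 2 ^ (t * (s * (2 * t)))
    s^≡ = trans (^-*-assoc s s (2 * t)) (^-*-assoc 2 t (s * (2 * t)))
    regroup₁ : ∀ y t s → 2 * y + t * (s * (2 * t)) ≡ 2 * y + 2 * (t * t * s)
    regroup₁ = solve-∀
    regroup₂ : ∀ y → 2 * y + 2 * y ≡ 4 * y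
    regroup₂ = solve-∀
    exponent : 2 * y + t * (s * (2 * t)) < 4 * y
    exponent = begin-strict
      2 * y + t * (s * (2 * t)) ≡⟨ regroup₁ y t s ⟩
      2 * y + 2 * (t * t * s)   <⟨ +-monoʳ-< (2 * y) (*-monoʳ-< 2 (*-monoˡ-< s {{m^n≢0 2 t}} (square<2^ w))) ⟩
      2 * y + 2 * y             ≡⟨ regroup₂ y ⟩
      4 * y                     ∎

  8y≡s² : 4 * y + 4 * y ≡ s * s
  8y≡s² = regroup (2 ^ (7 + w)) s
    where
    regroup : ∀ a s → 4 * (a * s) + 4 * (a * s) ≡ 2 * (2 * (2 * a)) * s
    regroup = solve-∀

  D-lower : (∀ p → Prime p → p ≤ s * s → p ≤ y) → 2 ^ (4 * y) ≤ D
  -- The split exposes the successor that `leibniz-triangle` expects; at 0 the claim is just 1 ≤ D.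
  -- With both parts of the binomial equal to 4y, their sum 8y is exactly the limit s² up to which
  -- all numbers divide D.
  D-lower gap with 4 * y in 4y≡
  ... | zero = >-nonZero⁻¹ D {{D≢0}}
    where D≢0 = m*n≢0 _ _ {{primeProduct≢0 0 y}} {{m^n≢0 (s !) (2 * t) {{s !≢0}}}}
  ... | suc i = begin
    2 ^ suc i                        ≤⟨ central-binomial-lower (suc i) ⟩
    binomial (suc i) (suc i)         ≤⟨ m≤n*m _ (suc i) ⟩
    suc i * binomial (suc i) (suc i) ≤⟨ ∣⇒≤ {{D≢0}} (leibniz-triangle D (s * s) divides-D (suc i) i
                                          (≤-reflexive (subst (λ k → k + k ≡ s * s) 4y≡ 8y≡s²))) ⟩
    D                                ∎
    where
    open ≤-Reasoning
    D≢0 = m*n≢0 _ _ {{primeProduct≢0 0 y}} {{m^n≢0 (s !) (2 * t) {{s !≢0}}}}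
    s²≡ : s * s ≡ 2 ^ (2 * t)
    s²≡ = trans (sym (^-distribˡ-+-* 2 t t)) (cong (2 ^_) (n+n≡2*n t))
    divides-D : ∀ k → 0 < k → k ≤ s * s → k ∣ D
    divides-D k 0<k k≤s² = ∣primeProduct*s!^e s y gap (2 * t) k 0<k (subst (k ≤_) s²≡ k≤s²) k≤s²

  prime-in-interval : ∃[ p ] Prime p × y < p × p ≤ s * s
  prime-in-interval with anyUpTo? (λ p → prime? p ×-dec y <? p) (suc (s * s))
  ... | yes (p , p< , pr , y<p) = p , pr , y<p , s≤s⁻¹ p<
  ... | no none = ⊥-elim (<⇒≱ D-upper (D-lower (λ p pr p≤ → ≮⇒≥ (λ y<p → none (p , s≤s p≤ , pr , y<p)))))

-- A prime whose cube is near a given number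

^3-distrib-* : ∀ x y → (x * y) ^ 3 ≡ x ^ 3 * y ^ 3
^3-distrib-* x y = regroup x y
  where
  regroup : ∀ x y → x * y * (x * y * (x * y * 1)) ≡ (x * (x * (x * 1))) * (y * (y * (y * 1)))
  regroup = solve-∀

^3-cancel-< : ∀ {x y} → x ^ 3 < y ^ 3 → x < y
^3-cancel-< {x} {y} h = ≰⇒> λ y≤x → <⇒≱ h (^-monoˡ-≤ 3 y≤x)

n<2^n : ∀ n → n < 2 ^ n
n<2^n zero    = ≤-refl
n<2^n (suc n) = +-mono-≤ (m^n>0 2 n) (≤-trans (n<2^n n) (≤-reflexive (sym (+-identityʳ _))))

-- Opaque, so that the large constants never unfold.
abstract
  -- The number y of the interval (y, 8y] above, as a function of w; it equals 2^(17 + 2w).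
  scale : ℕ → ℕ
  scale w = 2 ^ (7 + w) * 2 ^ (10 + w)

  scale≢0 : ∀ w → NonZero (scale w)
  scale≢0 w = m*n≢0 _ _ {{m^n≢0 2 (7 + w)}} {{m^n≢0 2 (10 + w)}}

  -- A crude starting point for the descent in `prime-with-cube-near`.
  n<scale^3 : ∀ n → n < scale n ^ 3
  n<scale^3 n = begin-strict
    n                 <⟨ n<2^n n ⟩
    2 ^ n             ≤⟨ ^-monoʳ-≤ 2 (m≤n+m n 7) ⟩
    2 ^ (7 + n)       ≤⟨ m≤m*n (2 ^ (7 + n)) (2 ^ (10 + n)) {{m^n≢0 2 (10 + n)}} ⟩
    scale n           ≤⟨ m≤m*n (scale n) (scale n ^ 2) {{m^n≢0 (scale n) 2 {{scale≢0 n}}}} ⟩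
    scale n ^ 3       ∎
    where open ≤-Reasoning

  prime-at-scale : ∀ w → ∃[ p ] Prime p × scale w < p × p ≤ 8 * scale w
  prime-at-scale w with prime-in-interval w
  ... | p , pr , y<p , p≤ = p , pr , y<p , ≤-trans p≤ (≤-reflexive (regroup (2 ^ (7 + w)) (2 ^ (10 + w)) refl))
    where
    regroup : ∀ a s → s ≡ 2 * (2 * (2 * a)) → s * s ≡ 8 * (a * s)
    regroup a s refl = identity a
      where
      identity : ∀ a → 2 * (2 * (2 * a)) * (2 * (2 * (2 * a))) ≡ 8 * (a * (2 * (2 * (2 * a))))
      identity = solve-∀

  scale-suc : ∀ w → scale (suc w) ≡ 4 * scale w
  scale-suc w = regroup (2 ^ (7 + w)) (2 ^ (10 + w))
    where
    regroup : ∀ a s → 2 * a * (2 * s) ≡ 4 * (a * s)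
    regroup = solve-∀

abstract
  -- The 32 is 8 · 4: a prime is at most 8 times its scale, and consecutive scales differ by the
  -- factor 4. The factor `scale 0` takes care of those M below the cube of the smallest scale.
  ratio : ℕ
  ratio = (32 * scale 0) ^ 3

  ratio≥₀ : (8 * scale 0) ^ 3 ≤ ratio
  ratio≥₀ = ^-monoˡ-≤ 3 (*-monoˡ-≤ (scale 0) (≤ᵇ⇒≤ 8 32 _))

  ratio≥ : 32 ^ 3 ≤ ratio
  ratio≥ = ^-monoˡ-≤ 3 (m≤m*n 32 (scale 0) {{scale≢0 0}})

-- Descend through the scales as long as their cube exceeds M. At the last such scale the next
-- smaller one has cube at most M, and the prime found is at most 32 times that smaller scale.
prime-with-cube-near : ∀ M → 0 < M → ∃[ q ] Prime q × M < q ^ 3 × q ^ 3 ≤ ratio * M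
prime-with-cube-near M 0<M = descend M (n<scale^3 M)
  where
  open ≤-Reasoning
  descend : ∀ w → M < scale w ^ 3 → ∃[ q ] Prime q × M < q ^ 3 × q ^ 3 ≤ ratio * M
  descend zero h with prime-at-scale 0
  ... | q , pr , y<q , q≤ = q , pr , <-≤-trans h (^-monoˡ-≤ 3 (<⇒≤ y<q)) , (begin
    q ^ 3      ≤⟨ ≤-trans (^-monoˡ-≤ 3 q≤) ratio≥₀ ⟩
    ratio      ≤⟨ m≤m*n ratio M {{>-nonZero 0<M}} ⟩
    ratio * M  ∎)
  descend (suc w) h with M <? scale w ^ 3
  ... | yes h′ = descend w h′
  ... | no ¬h′ with prime-at-scale (suc w)
  ...   | q , pr , y<q , q≤ = q , pr , <-≤-trans h (^-monoˡ-≤ 3 (<⇒≤ y<q)) , (begin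
    q ^ 3                    ≤⟨ ^-monoˡ-≤ 3 q≤ ⟩
    (8 * scale (suc w)) ^ 3  ≡⟨ cong (λ y → (8 * y) ^ 3) (scale-suc w) ⟩
    (8 * (4 * scale w)) ^ 3  ≡⟨ cong (_^ 3) (*-assoc 8 4 (scale w)) ⟨
    (32 * scale w) ^ 3       ≡⟨ ^3-distrib-* 32 (scale w) ⟩
    32 ^ 3 * scale w ^ 3     ≤⟨ *-mono-≤ ratio≥ (≮⇒≥ ¬h′) ⟩
    ratio * M                ∎)

-- Clique partitions from linear spaces

private variable
  A B : Set

-- Pigeonhole: the head of `xs` is deleted from `ys`, and uniqueness keeps the tail of `xs` inside
-- what remains.
length-⊆ : ∀ {xs ys : List A} → Unique xs → (∀ {x} → x ∈ xs → x ∈ ys) → length xs ≤ length ys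
length-⊆ {xs = []} _ _ = z≤n
length-⊆ {xs = x ∷ xs} (x∉xs ∷ uxs) sub with ∈-∃++ (sub (here refl))
... | us , vs , refl = begin
  suc (length xs)                ≤⟨ s≤s (length-⊆ uxs sub′) ⟩
  suc (length (us ++ vs))        ≡⟨ cong suc (length-++ us) ⟩
  suc (length us + length vs)    ≡⟨ +-suc (length us) (length vs) ⟨
  length us + suc (length vs)    ≡⟨ length-++ us ⟨
  length (us ++ x ∷ vs)          ∎
  where
  open ≤-Reasoning
  sub′ : ∀ {y} → y ∈ xs → y ∈ us ++ vs
  sub′ y∈xs with ∈-++⁻ us (sub (there y∈xs))
  ... | inj₁ y∈us         = ∈-++⁺ˡ y∈us
  ... | inj₂ (here refl)  = ⊥-elim (All.lookup x∉xs y∈xs refl)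
  ... | inj₂ (there y∈vs) = ∈-++⁺ʳ us y∈vs

length-concatMap-≤ : ∀ (f : A → List B) k xs → (∀ {x} → x ∈ xs → length (f x) ≤ k) →
                     length (concatMap f xs) ≤ length xs * k
length-concatMap-≤ f k []       _ = z≤n
length-concatMap-≤ f k (x ∷ xs) h = ≤-trans (≤-reflexive (length-++ (f x)))
  (+-mono-≤ (h (here refl)) (length-concatMap-≤ f k xs (h ∘ there)))

length-cartesianProduct : ∀ (xs : List A) (ys : List B) → length (cartesianProduct xs ys) ≡ length xs * length ys
length-cartesianProduct []       ys = refl
length-cartesianProduct (x ∷ xs) ys = trans (length-++ (map (x ,_) ys))
  (cong₂ _+_ (length-map (x ,_) ys) (length-cartesianProduct xs ys))

length-allFin : ∀ n → length (allFin n) ≡ n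
length-allFin _ = length-tabulate id

length-filterᵇ-map : ∀ (f : A → B) (p : B → Bool) xs → length (filterᵇ p (map f xs)) ≡ length (filterᵇ (p ∘ f) xs)
length-filterᵇ-map f p [] = refl
length-filterᵇ-map f p (x ∷ xs) with p (f x)
... | true  = cong suc (length-filterᵇ-map f p xs)
... | false = length-filterᵇ-map f p xs

length-filterᵇ≡1 : ∀ (p : A → Bool) {xs} {z} → Unique xs → z ∈ xs → T (p z) →
                   (∀ {x} → x ∈ xs → T (p x) → x ≡ z) → length (filterᵇ p xs) ≡ 1
length-filterᵇ≡1 p {z = z} uxs z∈xs pz only = ≤-antisym
  (length-⊆ {ys = z ∷ []} (Unique.filter⁺ (T? ∘ p) uxs)
    (λ x∈ → let x∈xs , px = ∈-filter⁻ (T? ∘ p) x∈ in here (only x∈xs px)))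
  (filter-some (T? ∘ p) (lose z∈xs pz))

-- Each of the k fibres holds at most two elements. In the application `xs` is a line and `f` tells
-- which parabola a point lies on.
length-fibres-≤ : ∀ (f : A → ℕ) k {xs} → Unique xs → (∀ {x} → x ∈ xs → f x < k) →
  (∀ {x y z} → x ∈ xs → y ∈ xs → z ∈ xs → f x ≡ f y → f x ≡ f z → x ≢ y → x ≢ z → y ≢ z → ⊥) →
  length xs ≤ k * 2
length-fibres-≤ f k {xs} uxs bound no-three = begin
  length xs                              ≤⟨ length-⊆ uxs (λ x∈ → ∈-concatMap⁺ fibre
                                              (lose (∈-upTo⁺ (bound x∈)) (∈-filter⁺ (λ x → f x ≟ _) x∈ refl))) ⟩
  length (concatMap fibre (upTo k))      ≤⟨ length-concatMap-≤ fibre 2 (upTo k) (λ {c} _ → small c) ⟩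
  length (upTo k) * 2                    ≡⟨ cong (_* 2) (length-upTo k) ⟩
  k * 2                                  ∎
  where
  open ≤-Reasoning
  fibre : ℕ → List _
  fibre c = filter (λ x → f x ≟ c) xs
  small : ∀ c → length (fibre c) ≤ 2
  small c with fibre c | Unique.filter⁺ (λ x → f x ≟ c) uxs | (λ {x} → ∈-filter⁻ (λ x → f x ≟ c) {v = x} {xs = xs})
  ... | []        | _ | _ = z≤n
  ... | _ ∷ []    | _ | _ = s≤s z≤n
  ... | _ ∷ _ ∷ [] | _ | _ = ≤-refl
  ... | x ∷ y ∷ z ∷ _ | (x≢y All.∷ x≢z All.∷ _) ∷ (y≢z All.∷ _) ∷ _ | mem
    with mem (here refl) | mem (there (here refl)) | mem (there (there (here refl)))
  ... | x∈ , fx | y∈ , fy | z∈ , fz =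
    ⊥-elim (no-three x∈ y∈ z∈ (trans fx (sym fy)) (trans fx (sym fz)) x≢y x≢z y≢z)

module _ {n} {G : Graph n} where

  compAdj-true⁺ : ∀ {i j} → i ≢ j → adj G i j ≡ false → compAdj G i j ≡ true
  compAdj-true⁺ {i} {j} i≢j e with i Fin.≟ j
  ... | yes i≡j = ⊥-elim (i≢j i≡j)
  ... | no  _   = cong not e

  compAdj-true⁻ : ∀ {i j} → compAdj G i j ≡ true → adj G i j ≡ false
  compAdj-true⁻ {i} {j} e with i Fin.≟ j
  ... | no _ = trans (sym (Bool.not-involutive _)) (cong not e)

  ∈-edgeList⁺ : ∀ {i j} → toℕ i < toℕ j → adj G i j ≡ true → (i , j) ∈ edgeList G
  ∈-edgeList⁺ {i} {j} i<j e = ∈-filter⁺ (T? ∘ _) (∈-cartesianProduct⁺ (∈-allFin i) (∈-allFin j))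
    (Equivalence.from T-∧ (<⇒<ᵇ i<j , Equivalence.from T-≡ e))

  ∈-edgeList⁻ : ∀ {i j} → (i , j) ∈ edgeList G → toℕ i < toℕ j
  ∈-edgeList⁻ {i} {j} e = <ᵇ⇒< (toℕ i) (toℕ j)
    (proj₁ (Equivalence.to T-∧ (proj₂ (∈-filter⁻ (T? ∘ _) {xs = cartesianProduct (allFin n) (allFin n)} e))))

  edgeCount-≤ : edgeCount G ≤ n * n
  edgeCount-≤ = begin
    edgeCount G                                          ≤⟨ length-filter (T? ∘ _) (cartesianProduct (allFin n) (allFin n)) ⟩
    length (cartesianProduct (allFin n) (allFin n))      ≡⟨ length-cartesianProduct (allFin n) (allFin n) ⟩
    length (allFin n) * length (allFin n)                ≡⟨ cong (λ l → l * l) (length-allFin n) ⟩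
    n * n                                                ∎
    where open ≤-Reasoning

-- A linear space on Fin n whose blocks are the fibres of the functions H a.
module LinearSpace {n s q K : ℕ} (H : Fin s → Fin n → ℕ)
  (H< : ∀ a i → H a i < q)
  (joined : ∀ {i j} → i ≢ j → ∃[ a ] H a i ≡ H a j)
  (unique : ∀ {i j a a′} → i ≢ j → H a i ≡ H a j → H a′ i ≡ H a′ j → a ≡ a′)
  (small  : ∀ a b → length (filter (λ i → H a i ≟ b) (allFin n)) ≤ K)
  (F : Graph n) where

  -- The class `a` suffices to name the block that loses `i`, since `i` lies in a single block of
  -- each class.
  Removed : Fin s → Fin n → Set
  Removed a i = ∃[ j ] toℕ i < toℕ j × adj F i j ≡ true × H a i ≡ H a j

  removed? : ∀ a i → Dec (Removed a i)
  removed? a i = any? λ j → toℕ i <? toℕ j ×-dec adj F i j Bool.≟ true ×-dec H a i ≟ H a j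

  Cut : Fin n → Fin n → Set
  Cut i j = ∃[ a ] H a i ≡ H a j × (Removed a i ⊎ Removed a j)

  cut? : ∀ i j → Dec (Cut i j)
  cut? i j = any? λ a → H a i ≟ H a j ×-dec (removed? a i ⊎-dec removed? a j)

  -- Orienting the pair makes every unordered pair give rise to one 2-clique only.
  CutPair : Fin n × Fin n → Set
  CutPair (i , j) = toℕ i < toℕ j × adj F i j ≡ false × Cut i j

  cutPair? : ∀ p → Dec (CutPair p)
  cutPair? (i , j) = toℕ i <? toℕ j ×-dec adj F i j Bool.≟ false ×-dec cut? i j

  pairs : List (Fin n × Fin n)
  pairs = cartesianProduct (allFin n) (allFin n)

  cutPairs : List (Fin n × Fin n)
  cutPairs = filter cutPair? pairs

  -- Cliques are handled through indices because different indices may give the same subset, for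
  -- instance two empty blocks, whereas the indices are listed without repetition.
  Index : Set
  Index = (Fin s × ℕ) ⊎ (Fin n × Fin n)

  indices : List Index
  indices = map inj₁ (cartesianProduct (allFin s) (upTo q)) ++ map inj₂ cutPairs

  Member : Index → Fin n → Set
  Member (inj₁ (a , b)) i = H a i ≡ b × ¬ Removed a i
  Member (inj₂ (u , v)) i = i ≡ u ⊎ i ≡ v

  member? : ∀ t i → Dec (Member t i)
  member? (inj₁ (a , b)) i = H a i ≟ b ×-dec ¬? (removed? a i)
  member? (inj₂ (u , v)) i = i Fin.≟ u ⊎-dec i Fin.≟ v

  clique : Index → Subset n
  clique t = tabulate (λ i → does (member? t i))

  cliques : List (Subset n)
  cliques = map clique indices

  ∈-clique⁻ : ∀ t i → lookup (clique t) i ≡ true → Member t i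
  ∈-clique⁻ t i e = invert (subst (Reflects (Member t i))
    (trans (sym (lookup∘tabulate (λ i → does (member? t i)) i)) e) (proof (member? t i)))

  ∈-clique⁺ : ∀ t i → Member t i → lookup (clique t) i ≡ true
  ∈-clique⁺ t i m = trans (lookup∘tabulate (λ i → does (member? t i)) i) (dec-true (member? t i) m)

  ∈-cutPairs⁻ : ∀ {p} → p ∈ cutPairs → CutPair p
  ∈-cutPairs⁻ = proj₂ ∘ ∈-filter⁻ cutPair? {xs = pairs}

  unique-pairs : Unique pairs
  unique-pairs = Unique.cartesianProduct⁺ (Unique.allFin⁺ n) (Unique.allFin⁺ n)

  unique-indices : Unique indices
  unique-indices = Unique.++⁺
    (Unique.map⁺ inj₁-injective (Unique.cartesianProduct⁺ (Unique.allFin⁺ s) (Unique.upTo⁺ q)))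
    (Unique.map⁺ inj₂-injective (Unique.filter⁺ cutPair? unique-pairs))
    λ { (x∈₁ , x∈₂) → case (∈-map⁻ inj₁ x∈₁) (∈-map⁻ inj₂ x∈₂) }
    where
    case : ∀ {x : Index} → (∃[ y ] y ∈ cartesianProduct (allFin s) (upTo q) × x ≡ inj₁ y) →
           (∃[ z ] z ∈ cutPairs × x ≡ inj₂ z) → ⊥
    case (_ , _ , refl) (_ , _ , ())

  -- An edge of `F` inside the block would have caused the removal of its smaller endpoint.
  block-independent : ∀ {a b i j} → Member (inj₁ (a , b)) i → Member (inj₁ (a , b)) j → i ≢ j → adj F i j ≡ false
  block-independent {i = i} {j} (refl , ¬ri) (e , ¬rj) i≢j with adj F i j in adj≡ | <-cmp (toℕ i) (toℕ j)
  ... | false | _ = refl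
  ... | true | tri< i<j _ _ = ⊥-elim (¬ri (j , i<j , adj≡ , sym e))
  ... | true | tri≈ _ i≡j _ = ⊥-elim (i≢j (toℕ-injective i≡j))
  ... | true | tri> _ _ j<i = ⊥-elim (¬rj (i , j<i , trans (adjSym F j i) adj≡ , e))

  cliques-valid : ∀ {t} → t ∈ indices → IsClique (complement F) (clique t)
  cliques-valid {inj₁ (a , b)} _ i j i∈ j∈ i≢j =
    compAdj-true⁺ {G = F} i≢j (block-independent (∈-clique⁻ _ i i∈) (∈-clique⁻ _ j j∈) i≢j)
  cliques-valid {inj₂ (u , v)} t∈ i j i∈ j∈ i≢j with ∈-++⁻ (map inj₁ (cartesianProduct (allFin s) (upTo q))) t∈
  ... | inj₁ t∈₁ with ∈-map⁻ inj₁ t∈₁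
  ...   | _ , _ , ()
  cliques-valid {inj₂ (u , v)} t∈ i j i∈ j∈ i≢j | inj₂ t∈₂ with ∈-map⁻ inj₂ t∈₂
  ...   | _ , p∈ , refl with ∈-cutPairs⁻ p∈ | ∈-clique⁻ (inj₂ (u , v)) i i∈ | ∈-clique⁻ (inj₂ (u , v)) j j∈
  ...     | _ | inj₁ refl | inj₁ refl = ⊥-elim (i≢j refl)
  ...     | _ | inj₂ refl | inj₂ refl = ⊥-elim (i≢j refl)
  ...     | _ , e , _ | inj₁ refl | inj₂ refl = compAdj-true⁺ {G = F} i≢j e
  ...     | _ , e , _ | inj₂ refl | inj₁ refl = compAdj-true⁺ {G = F} i≢j (trans (adjSym F v u) e)

  CoveredOnce : Fin n → Fin n → Set
  CoveredOnce i j = ∃[ t ] t ∈ indices × Member t i × Member t j ×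
                    (∀ {t′} → t′ ∈ indices → Member t′ i → Member t′ j → t′ ≡ t)

  -- If the pair is cut, its only common block has lost one of the two points, which leaves the
  -- 2-clique. Otherwise both points survive in that block and the pair is absent from `cutPairs`.
  coveredOnce-< : ∀ {i j} → toℕ i < toℕ j → adj F i j ≡ false → CoveredOnce i j
  coveredOnce-< {i} {j} i<j ij∉F with joined (<⇒≢ i<j ∘ cong toℕ) | cut? i j
  ... | _ | yes c@(a , Hi≡Hj , removed) =
    inj₂ (i , j) , ∈-++⁺ʳ _ (∈-map⁺ inj₂ (∈-filter⁺ cutPair? (∈-cartesianProduct⁺ (∈-allFin i) (∈-allFin j)) (i<j , ij∉F , c))) ,
    inj₁ refl , inj₂ refl , only
    where
    i≢j = <⇒≢ i<j ∘ cong toℕ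
    only : ∀ {t′} → t′ ∈ indices → Member t′ i → Member t′ j → t′ ≡ inj₂ (i , j)
    only {inj₁ (a′ , b)} _ (ei , ¬ri) (ej , ¬rj) with unique {a = a} {a′} i≢j Hi≡Hj (trans ei (sym ej))
    ... | refl = ⊥-elim ([ ¬ri , ¬rj ] removed)
    only {inj₂ (u , v)} _ (inj₁ refl) (inj₁ refl) = ⊥-elim (i≢j refl)
    only {inj₂ (u , v)} _ (inj₁ refl) (inj₂ refl) = refl
    only {inj₂ (u , v)} _ (inj₂ refl) (inj₂ refl) = ⊥-elim (i≢j refl)
    -- The reversed pair (j, i) is not in `cutPairs`, whose pairs are increasing.
    only {inj₂ (u , v)} t∈ (inj₂ refl) (inj₁ refl) with ∈-++⁻ (map inj₁ (cartesianProduct (allFin s) (upTo q))) t∈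
    ... | inj₁ t∈₁ with ∈-map⁻ inj₁ t∈₁
    ...   | _ , _ , ()
    only {inj₂ (u , v)} t∈ (inj₂ refl) (inj₁ refl) | inj₂ t∈₂ with ∈-map⁻ inj₂ t∈₂
    ...   | _ , p∈ , refl = ⊥-elim (<-asym i<j (proj₁ (∈-cutPairs⁻ p∈)))
  ... | a , Hi≡Hj | no ¬c =
    inj₁ (a , H a i) , ∈-++⁺ˡ (∈-map⁺ inj₁ (∈-cartesianProduct⁺ (∈-allFin a) (∈-upTo⁺ (H< a i)))) ,
    (refl , λ r → ¬c (a , Hi≡Hj , inj₁ r)) , (sym Hi≡Hj , λ r → ¬c (a , Hi≡Hj , inj₂ r)) , only
    where
    i≢j = <⇒≢ i<j ∘ cong toℕ
    only : ∀ {t′} → t′ ∈ indices → Member t′ i → Member t′ j → t′ ≡ inj₁ (a , H a i)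
    only {inj₁ (a′ , b)} _ (refl , _) (ej , _) with unique {a = a} {a′} i≢j Hi≡Hj (sym ej)
    ... | refl = refl
    only {inj₂ (u , v)} _ (inj₁ refl) (inj₁ refl) = ⊥-elim (i≢j refl)
    only {inj₂ (u , v)} _ (inj₂ refl) (inj₂ refl) = ⊥-elim (i≢j refl)
    only {inj₂ (u , v)} t∈ mi mj with ∈-++⁻ (map inj₁ (cartesianProduct (allFin s) (upTo q))) t∈
    ... | inj₁ t∈₁ with ∈-map⁻ inj₁ t∈₁
    ...   | _ , _ , ()
    only {inj₂ (u , v)} t∈ mi mj | inj₂ t∈₂ with ∈-map⁻ inj₂ t∈₂
    ...   | _ , p∈ , refl with ∈-cutPairs⁻ p∈ | mi | mj
    ...     | _ , _ , c | inj₁ refl | inj₂ refl = ⊥-elim (¬c c)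
    ...     | v<u , _ , _ | inj₂ refl | inj₁ refl = ⊥-elim (<-asym i<j v<u)
    ...     | _ | inj₁ refl | inj₁ refl = ⊥-elim (i≢j refl)
    ...     | _ | inj₂ refl | inj₂ refl = ⊥-elim (i≢j refl)

  coveredOnce : ∀ {i j} → i ≢ j → adj F i j ≡ false → CoveredOnce i j
  coveredOnce {i} {j} i≢j ij∉F with <-cmp (toℕ i) (toℕ j)
  ... | tri< i<j _ _ = coveredOnce-< i<j ij∉F
  ... | tri≈ _ i≡j _ = ⊥-elim (i≢j (toℕ-injective i≡j))
  ... | tri> _ _ j<i with coveredOnce-< j<i (trans (adjSym F j i) ij∉F)
  ...   | t , t∈ , mj , mi , only = t , t∈ , mi , mj , λ t′∈ mi mj → only t′∈ mj mi

  cliques-count : ∀ {i j} → CoveredOnce i j → countContaining cliques i j ≡ 1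
  cliques-count {i} {j} (t , t∈ , mi , mj , only) =
    trans (length-filterᵇ-map clique _ indices)
      (length-filterᵇ≡1 _ unique-indices t∈
        (Equivalence.from T-∧ (Equivalence.from T-≡ (∈-clique⁺ t i mi) , Equivalence.from T-≡ (∈-clique⁺ t j mj)))
        (λ {t′} t′∈ p → let pi , pj = Equivalence.to T-∧ p in
          only t′∈ (∈-clique⁻ t′ i (Equivalence.to T-≡ pi)) (∈-clique⁻ t′ j (Equivalence.to T-≡ pj))))

  cliques-partition : IsCliquePartition (complement F) cliques
  cliques-partition = All.map⁺ (All.tabulate cliques-valid) ,
    λ i j i≢j e → cliques-count (coveredOnce i≢j (compAdj-true⁻ {G = F} e))

  -- Quantifying over `a` avoids selecting the class; for distinct `u` and `v` it is determined by
  -- `unique`.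
  OnBlock : Fin n → Fin n → Fin n → Set
  OnBlock u v w = ∃[ a ] H a u ≡ H a v × H a w ≡ H a u

  onBlock? : ∀ u v w → Dec (OnBlock u v w)
  onBlock? u v w = any? λ a → H a u ≟ H a v ×-dec H a w ≟ H a u

  blockThrough : Fin n → Fin n → List (Fin n)
  blockThrough u v = filter (onBlock? u v) (allFin n)

  length-blockThrough : ∀ {u v} → u ≢ v → length (blockThrough u v) ≤ K
  length-blockThrough {u} {v} u≢v with joined u≢v
  ... | a , e = ≤-trans (length-⊆ (Unique.filter⁺ (onBlock? u v) (Unique.allFin⁺ n)) sub) (small a (H a u))
    where
    sub : ∀ {w} → w ∈ blockThrough u v → w ∈ filter (λ i → H a i ≟ H a u) (allFin n)
    sub {w} w∈ with ∈-filter⁻ (onBlock? u v) {xs = allFin n} w∈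
    ... | w∈′ , a′ , e′ , e″ with unique {a = a} {a′} u≢v e e′
    ...   | refl = ∈-filter⁺ (λ i → H a i ≟ H a u) w∈′ e″

  -- An edge with smaller endpoint u removes u from the block through the edge, cutting u off from
  -- the points of that block. Both orders are listed, since u may be either entry of an increasing
  -- pair.
  pairsCutBy : Fin n × Fin n → List (Fin n × Fin n)
  pairsCutBy (u , v) = map (u ,_) (blockThrough u v) ++ map (_, u) (blockThrough u v)

  -- Each cut pair is charged to an edge of `F` that removed one of its two points from their block.
  length-cutPairs : length cutPairs ≤ edgeCount F * (K + K)
  length-cutPairs = ≤-trans (length-⊆ (Unique.filter⁺ cutPair? unique-pairs) sub)
    (length-concatMap-≤ pairsCutBy (K + K) (edgeList F) bound)
    where
    bound : ∀ {e} → e ∈ edgeList F → length (pairsCutBy e) ≤ K + K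
    bound {u , v} e∈ = begin
      length (pairsCutBy (u , v))                               ≡⟨ length-++ (map (u ,_) (blockThrough u v)) ⟩
      length (map (u ,_) (blockThrough u v)) + length (map (_, u) (blockThrough u v))
                                                                ≡⟨ cong₂ _+_ (length-map _ (blockThrough u v)) (length-map _ (blockThrough u v)) ⟩
      length (blockThrough u v) + length (blockThrough u v)     ≤⟨ +-mono-≤ le le ⟩
      K + K                                                     ∎
      where
      open ≤-Reasoning
      le = length-blockThrough (<⇒≢ (∈-edgeList⁻ {G = F} e∈) ∘ cong toℕ)
    sub : ∀ {p} → p ∈ cutPairs → p ∈ concatMap pairsCutBy (edgeList F)
    sub {i , j} p∈ with ∈-cutPairs⁻ p∈
    ... | _ , _ , a , e , inj₁ (v , i<v , iv∈F , e′) = ∈-concatMap⁺ pairsCutBy (lose (∈-edgeList⁺ {G = F} i<v iv∈F)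
      (∈-++⁺ˡ (∈-map⁺ (i ,_) (∈-filter⁺ (onBlock? i v) (∈-allFin j) (a , e′ , sym e)))))
    ... | _ , _ , a , e , inj₂ (v , j<v , jv∈F , e′) = ∈-concatMap⁺ pairsCutBy (lose (∈-edgeList⁺ {G = F} j<v jv∈F)
      (∈-++⁺ʳ (map (j ,_) (blockThrough j v)) (∈-map⁺ (_, j) (∈-filter⁺ (onBlock? j v) (∈-allFin i) (a , e′ , e)))))

  length-cliques : length cliques ≤ s * q + edgeCount F * (K + K)
  length-cliques = begin
    length cliques                                                     ≡⟨ length-map clique indices ⟩
    length indices                                                     ≡⟨ length-++ (map inj₁ blocks) ⟩
    length (map inj₁ blocks) + length (map {B = Index} inj₂ cutPairs)  ≡⟨ cong₂ _+_ (length-map inj₁ blocks) (length-map inj₂ cutPairs) ⟩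
    length blocks + length cutPairs                                    ≡⟨ cong (_+ length cutPairs)
        (trans (length-cartesianProduct (allFin s) (upTo q)) (cong₂ _*_ (length-allFin s) (length-upTo q))) ⟩
    s * q + length cutPairs                                            ≤⟨ +-monoʳ-≤ (s * q) length-cutPairs ⟩
    s * q + edgeCount F * (K + K)                                      ∎
    where
    open ≤-Reasoning
    blocks = cartesianProduct (allFin s) (upTo q)

-- Parabolas in the affine plane

module _ {q : ℕ} .{{_ : NonZero q}} where

  -- Congruences are moved to divisibility in ℤ, where identities involving subtraction are open to
  -- the ring solver.
  %-≡⇒∣ : ∀ u v → u % q ≡ v % q → + q ∣ℤ + u ℤ.- + v
  %-≡⇒∣ u v e = Signed.divides (+ (u / q) ℤ.- + (v / q)) (begin
    + u ℤ.- + v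
      ≡⟨ cong₂ ℤ._-_ (expand u) (expand v) ⟩
    (+ (u % q) ℤ.+ + (u / q) ℤ.* + q) ℤ.- (+ (v % q) ℤ.+ + (v / q) ℤ.* + q)
      ≡⟨ cong (λ r → (+ (u % q) ℤ.+ + (u / q) ℤ.* + q) ℤ.- (+ r ℤ.+ + (v / q) ℤ.* + q)) e ⟨
    (+ (u % q) ℤ.+ + (u / q) ℤ.* + q) ℤ.- (+ (u % q) ℤ.+ + (v / q) ℤ.* + q)
      ≡⟨ regroup (+ (u % q)) (+ (u / q)) (+ (v / q)) (+ q) ⟩
    (+ (u / q) ℤ.- + (v / q)) ℤ.* + q ∎)
    where
    open ≡-Reasoning
    expand : ∀ u → + u ≡ + (u % q) ℤ.+ + (u / q) ℤ.* + q
    expand u = trans (cong +_ (m≡m%n+[m/n]*n u q)) (cong (ℤ._+_ (+ (u % q))) (ℤ.pos-* (u / q) q))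
    regroup : ∀ r a b q → (r ℤ.+ a ℤ.* q) ℤ.- (r ℤ.+ b ℤ.* q) ≡ (a ℤ.- b) ℤ.* q
    regroup = ℤ.solve-∀

  -- The sign of the quotient tells which of `u` and `v` is the other plus a natural multiple of
  -- `q`.
  ∣⇒%-≡ : ∀ u v → + q ∣ℤ + u ℤ.- + v → u % q ≡ v % q
  ∣⇒%-≡ u v (Signed.divides (+ k) e) = trans (cong (_% q) (ℤ.+-injective u≡)) ([m+kn]%n≡m%n v k q)
    where
    open ≡-Reasoning
    cancel : ∀ u v → u ≡ v ℤ.+ (u ℤ.- v)
    cancel = ℤ.solve-∀
    u≡ : + u ≡ + (v + k * q)
    u≡ = begin
      + u                       ≡⟨ cancel (+ u) (+ v) ⟩
      + v ℤ.+ (+ u ℤ.- + v)     ≡⟨ cong (ℤ._+_ (+ v)) (trans e (sym (ℤ.pos-* k q))) ⟩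
      + (v + k * q)             ∎
  ∣⇒%-≡ u v (Signed.divides -[1+ k ] e) = sym (trans (cong (_% q) (ℤ.+-injective v≡)) ([m+kn]%n≡m%n u (suc k) q))
    where
    open ≡-Reasoning
    cancel : ∀ u v → v ≡ u ℤ.+ ℤ.- (u ℤ.- v)
    cancel = ℤ.solve-∀
    v≡ : + v ≡ + (u + suc k * q)
    v≡ = begin
      + v                           ≡⟨ cancel (+ u) (+ v) ⟩
      + u ℤ.+ ℤ.- (+ u ℤ.- + v)     ≡⟨ cong (λ z → + u ℤ.+ ℤ.- z) e ⟩
      + u ℤ.+ ℤ.- (-[1+ k ] ℤ.* + q) ≡⟨ cong (ℤ._+_ (+ u)) (ℤ.neg-distribˡ-* -[1+ k ] (+ q)) ⟩
      + u ℤ.+ + suc k ℤ.* + q       ≡⟨ cong (ℤ._+_ (+ u)) (ℤ.pos-* (suc k) q) ⟨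
      + (u + suc k * q)             ∎

  ∣⇒≡ : ∀ {u v} → u < q → v < q → + q ∣ℤ + u ℤ.- + v → u ≡ v
  ∣⇒≡ {u} {v} u<q v<q d = trans (sym (m<n⇒m%n≡m u<q)) (trans (∣⇒%-≡ u v d) (m<n⇒m%n≡m v<q))

euclidsLemmaℤ : ∀ {q} → Prime q → ∀ u v → + q ∣ℤ u ℤ.* v → + q ∣ℤ u ⊎ + q ∣ℤ v
euclidsLemmaℤ {q} pr u v d with euclidsLemma ℤ.∣ u ∣ ℤ.∣ v ∣ pr (subst (q ∣_) (ℤ.abs-* u v) (Signed.∣⇒∣ᵤ d))
... | inj₁ e = inj₁ (Signed.∣ᵤ⇒∣ e)
... | inj₂ e = inj₂ (Signed.∣ᵤ⇒∣ e)

-- Bézout's identity for q and |d| inverts |d|; the sign of d is then moved to the inverse.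
inverse-mod-prime : ∀ {q} → Prime q → ∀ d → ¬ + q ∣ℤ d → ∃[ u ] + q ∣ℤ u ℤ.* d ℤ.- + 1
inverse-mod-prime {q} pr d q∤d with inverse-abs | ℤ.+∣i∣≡i⊎+∣i∣≡-i d
  where
  inverse-abs : ∃[ u ] + q ∣ℤ u ℤ.* + ℤ.∣ d ∣ ℤ.- + 1
  inverse-abs with coprime-Bézout (prime∤⇒coprime pr (q∤d ∘ Signed.∣ᵤ⇒∣))
  ... | Bézout.+- x y e = ℤ.- + y , Signed.divides (ℤ.- + x) (begin
    ℤ.- + y ℤ.* + ℤ.∣ d ∣ ℤ.- + 1         ≡⟨ regroup (+ y) (+ ℤ.∣ d ∣) ⟩
    ℤ.- (+ 1 ℤ.+ + y ℤ.* + ℤ.∣ d ∣)       ≡⟨ cong (λ z → ℤ.- (+ 1 ℤ.+ z)) (ℤ.pos-* y ℤ.∣ d ∣) ⟨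
    ℤ.- + (1 + y * ℤ.∣ d ∣)               ≡⟨ cong (λ z → ℤ.- + z) e ⟩
    ℤ.- + (x * q)                         ≡⟨ cong ℤ.-_ (ℤ.pos-* x q) ⟩
    ℤ.- (+ x ℤ.* + q)                     ≡⟨ ℤ.neg-distribˡ-* (+ x) (+ q) ⟩
    ℤ.- + x ℤ.* + q                       ∎)
    where
    open ≡-Reasoning
    regroup : ∀ y d → ℤ.- y ℤ.* d ℤ.- + 1 ≡ ℤ.- (+ 1 ℤ.+ y ℤ.* d)
    regroup = ℤ.solve-∀
  ... | Bézout.-+ x y e = + y , Signed.divides (+ x) (begin
    + y ℤ.* + ℤ.∣ d ∣ ℤ.- + 1             ≡⟨ cong (ℤ._- + 1) (ℤ.pos-* y ℤ.∣ d ∣) ⟨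
    + (y * ℤ.∣ d ∣) ℤ.- + 1               ≡⟨ cong (λ z → + z ℤ.- + 1) e ⟨
    + (1 + x * q) ℤ.- + 1                 ≡⟨ cong (λ z → + 1 ℤ.+ z ℤ.- + 1) (ℤ.pos-* x q) ⟩
    + 1 ℤ.+ + x ℤ.* + q ℤ.- + 1           ≡⟨ regroup (+ x ℤ.* + q) ⟩
    + x ℤ.* + q                           ∎)
    where
    open ≡-Reasoning
    regroup : ∀ z → + 1 ℤ.+ z ℤ.- + 1 ≡ z
    regroup = ℤ.solve-∀
... | u , h | inj₁ e = u , subst (λ z → + q ∣ℤ u ℤ.* z ℤ.- + 1) e h
... | u , h | inj₂ e = ℤ.- u , subst (λ z → + q ∣ℤ z ℤ.- + 1) (trans (cong (u ℤ.*_) e) (neg-swap u d)) h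
  where
  neg-swap : ∀ u d → u ℤ.* ℤ.- d ≡ ℤ.- u ℤ.* d
  neg-swap = ℤ.solve-∀

-- Points (x, x² + c) and (y, y² + d) of the plane over ℤ/q on a common line of slope − a.
record Collinear (q : ℕ) (a x c y d : ℤ) : Set where
  constructor collinear
  field
    divisibility : + q ∣ℤ (x ℤ.* x ℤ.+ c ℤ.+ a ℤ.* x) ℤ.- (y ℤ.* y ℤ.+ d ℤ.+ a ℤ.* y)

collinear-vertical : ∀ {q} a x c d → Collinear q a x c x d → + q ∣ℤ c ℤ.- d
collinear-vertical {q} a x c d (collinear h) = subst (+ q ∣ℤ_) (cancel x c d a) h
  where
  cancel : ∀ x c d a → (x ℤ.* x ℤ.+ c ℤ.+ a ℤ.* x) ℤ.- (x ℤ.* x ℤ.+ d ℤ.+ a ℤ.* x) ≡ c ℤ.- d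
  cancel = ℤ.solve-∀

-- Subtracting the two congruences cancels the ordinates and leaves (a - b)(x - y).
collinear-two-slopes : ∀ {q} → Prime q → ∀ a b x c y d → Collinear q a x c y d → Collinear q b x c y d →
                       + q ∣ℤ a ℤ.- b ⊎ + q ∣ℤ x ℤ.- y
collinear-two-slopes {q} pr a b x c y d (collinear h) (collinear h′) = euclidsLemmaℤ pr (a ℤ.- b) (x ℤ.- y)
  (subst (+ q ∣ℤ_) (difference (x ℤ.* x ℤ.+ c) (y ℤ.* y ℤ.+ d) x y a b) (Signed.∣m∣n⇒∣m-n h h′))
  where
  difference : ∀ p r x y a b → ((p ℤ.+ a ℤ.* x) ℤ.- (r ℤ.+ a ℤ.* y)) ℤ.- ((p ℤ.+ b ℤ.* x) ℤ.- (r ℤ.+ b ℤ.* y)) ≡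
               (a ℤ.- b) ℤ.* (x ℤ.- y)
  difference = ℤ.solve-∀

-- On a common parabola the `c` cancels and the difference factors as (x - y)(x + y + a).
collinear-parabola : ∀ {q} → Prime q → ∀ a x y c → Collinear q a x c y c → + q ∣ℤ x ℤ.- y ⊎ + q ∣ℤ x ℤ.+ y ℤ.+ a
collinear-parabola {q} pr a x y c (collinear h) = euclidsLemmaℤ pr (x ℤ.- y) (x ℤ.+ y ℤ.+ a) (subst (+ q ∣ℤ_) (factor x y c a) h)
  where
  factor : ∀ x y c a → (x ℤ.* x ℤ.+ c ℤ.+ a ℤ.* x) ℤ.- (y ℤ.* y ℤ.+ c ℤ.+ a ℤ.* y) ≡ (x ℤ.- y) ℤ.* (x ℤ.+ y ℤ.+ a)
  factor = ℤ.solve-∀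

-- With r the difference of the ordinates and u an inverse of x - y, the condition r + a (x - y) ≡ 0
-- is solved by a ≡ - u r, reduced modulo q; `k′` accounts for the reduction.
collinear-slope : ∀ {q} → Prime q → ∀ x c y d → ¬ + q ∣ℤ x ℤ.- y → ∃[ a ] a < q × Collinear q (+ a) x c y d
collinear-slope {q} pr x c y d q∤x-y with inverse-mod-prime pr (x ℤ.- y) q∤x-y
... | u , h = a , ℤ.n%ℕd<d target q , collinear (subst (+ q ∣ℤ_) (sym eq)
  (Signed.∣m∣n⇒∣m-n (Signed.∣n⇒∣m*n (ℤ.- r) h) (Signed.divides k′ refl)))
  where
  instance
    q≢0 : NonZero q
    q≢0 = prime⇒nonZero pr
  r target k′ : ℤ
  r = (x ℤ.* x ℤ.+ c) ℤ.- (y ℤ.* y ℤ.+ d)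
  target = ℤ.- u ℤ.* r
  k′ = target ℤ./ℕ q ℤ.* (x ℤ.- y)
  a : ℕ
  a = target ℤ.%ℕ q
  regroup : ∀ p s x y u a k q → ℤ.- u ℤ.* (p ℤ.- s) ≡ a ℤ.+ k ℤ.* q →
    (p ℤ.+ a ℤ.* x) ℤ.- (s ℤ.+ a ℤ.* y) ≡ ℤ.- (p ℤ.- s) ℤ.* (u ℤ.* (x ℤ.- y) ℤ.- + 1) ℤ.- k ℤ.* (x ℤ.- y) ℤ.* q
  regroup p s x y u a k q e = begin
    (p ℤ.+ a ℤ.* x) ℤ.- (s ℤ.+ a ℤ.* y)
      ≡⟨ insert p s x y a k q ⟩
    (p ℤ.- s) ℤ.+ (a ℤ.+ k ℤ.* q) ℤ.* (x ℤ.- y) ℤ.- k ℤ.* (x ℤ.- y) ℤ.* q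
      ≡⟨ cong (λ z → (p ℤ.- s) ℤ.+ z ℤ.* (x ℤ.- y) ℤ.- k ℤ.* (x ℤ.- y) ℤ.* q) e ⟨
    (p ℤ.- s) ℤ.+ ℤ.- u ℤ.* (p ℤ.- s) ℤ.* (x ℤ.- y) ℤ.- k ℤ.* (x ℤ.- y) ℤ.* q
      ≡⟨ cong (ℤ._- k ℤ.* (x ℤ.- y) ℤ.* q) (factor (p ℤ.- s) u (x ℤ.- y)) ⟩
    ℤ.- (p ℤ.- s) ℤ.* (u ℤ.* (x ℤ.- y) ℤ.- + 1) ℤ.- k ℤ.* (x ℤ.- y) ℤ.* q ∎
    where
    open ≡-Reasoning
    insert : ∀ p s x y a k q → (p ℤ.+ a ℤ.* x) ℤ.- (s ℤ.+ a ℤ.* y) ≡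
             (p ℤ.- s) ℤ.+ (a ℤ.+ k ℤ.* q) ℤ.* (x ℤ.- y) ℤ.- k ℤ.* (x ℤ.- y) ℤ.* q
    insert = ℤ.solve-∀
    factor : ∀ r u d → r ℤ.+ ℤ.- u ℤ.* r ℤ.* d ≡ ℤ.- r ℤ.* (u ℤ.* d ℤ.- + 1)
    factor = ℤ.solve-∀
  eq = regroup (x ℤ.* x ℤ.+ c) (y ℤ.* y ℤ.+ d) x y u (+ a) (target ℤ./ℕ q) (+ q) (ℤ.a≡a%ℕn+[a/ℕn]*n target q)

module Parabolas {q n : ℕ} (pr : Prime q) (n<q² : n < q * q) where
  private instance
    q≢0 : NonZero q
    q≢0 = prime⇒nonZero pr

  abscissa height : Fin n → ℕ
  abscissa i = toℕ i % q
  height   i = toℕ i / q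

  -- For the point (X, Y) with Y = x² + c this is Y + a X, which is constant modulo q on each line
  -- of slope - a.
  intercept : ℕ → Fin n → ℕ
  intercept a i = abscissa i * abscissa i + height i + a * abscissa i

  -- The class `Fin.zero` consists of the vertical lines, `Fin.suc a` of those of slope - a; the
  -- value labels one of the q lines in the class.
  parallelClass : Fin (suc q) → Fin n → ℕ
  parallelClass Fin.zero    i = abscissa i
  parallelClass (Fin.suc a) i = intercept (toℕ a) i % q

  parallelClass-< : ∀ a i → parallelClass a i < q
  parallelClass-< Fin.zero    i = m%n<n (toℕ i) q
  parallelClass-< (Fin.suc a) i = m%n<n (intercept (toℕ a) i) q

  height-≤ : ∀ i → height i ≤ n / q
  height-≤ i = /-monoˡ-≤ q (<⇒≤ (toℕ<n i))

  -- Here n < q² enters: heights congruent modulo q are equal, so distinct vertices occupy distinct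
  -- points of the plane.
  height-< : ∀ i → height i < q
  height-< i = ≤-<-trans (height-≤ i) (m<n*o⇒m/o<n n<q²)

  coordinates-injective : ∀ {i j} → abscissa i ≡ abscissa j → height i ≡ height j → i ≡ j
  coordinates-injective {i} {j} x≡ c≡ = toℕ-injective (begin
    toℕ i                          ≡⟨ m≡m%n+[m/n]*n (toℕ i) q ⟩
    abscissa i + height i * q      ≡⟨ cong₂ (λ x c → x + c * q) x≡ c≡ ⟩
    abscissa j + height j * q      ≡⟨ m≡m%n+[m/n]*n (toℕ j) q ⟨
    toℕ j                          ∎)
    where open ≡-Reasoning

  private
    X C : Fin n → ℤ
    X i = + abscissa i
    C i = + height i

    Aligned : ℕ → Fin n → Fin n → Set
    Aligned a i j = Collinear q (+ a) (X i) (C i) (X j) (C j)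

  intercept-ℤ : ∀ a i → + intercept a i ≡ X i ℤ.* X i ℤ.+ C i ℤ.+ + a ℤ.* X i
  intercept-ℤ a i = cong₂ ℤ._+_ (cong (ℤ._+ C i) (ℤ.pos-* (abscissa i) (abscissa i))) (ℤ.pos-* a (abscissa i))

  aligned⁺ : ∀ a i j → intercept a i % q ≡ intercept a j % q → Aligned a i j
  aligned⁺ a i j e = collinear (subst₂ (λ u v → + q ∣ℤ u ℤ.- v) (intercept-ℤ a i) (intercept-ℤ a j)
    (%-≡⇒∣ (intercept a i) (intercept a j) e))

  aligned⁻ : ∀ a i j → Aligned a i j → intercept a i % q ≡ intercept a j % q
  aligned⁻ a i j (collinear d) = ∣⇒%-≡ (intercept a i) (intercept a j)
    (subst₂ (λ u v → + q ∣ℤ u ℤ.- v) (sym (intercept-ℤ a i)) (sym (intercept-ℤ a j)) d)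

  abscissa-≡ : ∀ {i j} → + q ∣ℤ X i ℤ.- X j → abscissa i ≡ abscissa j
  abscissa-≡ {i} {j} = ∣⇒≡ (m%n<n (toℕ i) q) (m%n<n (toℕ j) q)

  -- With equal abscissas only the heights are left in the congruence, and both are below q.
  aligned-vertical : ∀ a {i j} → abscissa i ≡ abscissa j → Aligned a i j → i ≡ j
  aligned-vertical a {i} {j} x≡ h = coordinates-injective x≡ (∣⇒≡ (height-< i) (height-< j)
    (collinear-vertical (+ a) (X i) (C i) (C j)
      (subst (λ x → Collinear q (+ a) (X i) (C i) (+ x) (C j)) (sym x≡) h)))

  parallelClass-unique : ∀ {i j a a′} → i ≢ j → parallelClass a i ≡ parallelClass a j →
                         parallelClass a′ i ≡ parallelClass a′ j → a ≡ a′
  parallelClass-unique {a = Fin.zero}  {Fin.zero}   i≢j e e′ = refl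
  parallelClass-unique {i} {j} {Fin.zero}  {Fin.suc a′} i≢j e e′ =
    ⊥-elim (i≢j (aligned-vertical (toℕ a′) e (aligned⁺ (toℕ a′) i j e′)))
  parallelClass-unique {i} {j} {Fin.suc a} {Fin.zero}   i≢j e e′ =
    ⊥-elim (i≢j (aligned-vertical (toℕ a) e′ (aligned⁺ (toℕ a) i j e)))
  parallelClass-unique {i} {j} {Fin.suc a} {Fin.suc a′} i≢j e e′ =
    [ (λ d → cong Fin.suc (toℕ-injective (∣⇒≡ (toℕ<n a) (toℕ<n a′) d)))
    , (λ d → ⊥-elim (i≢j (aligned-vertical (toℕ a) (abscissa-≡ d) (aligned⁺ (toℕ a) i j e))))
    ]′ (collinear-two-slopes pr (+ toℕ a) (+ toℕ a′) (X i) (C i) (X j) (C j)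
         (aligned⁺ (toℕ a) i j e) (aligned⁺ (toℕ a′) i j e′))

  parallelClass-joined : ∀ i j → ∃[ a ] parallelClass a i ≡ parallelClass a j
  parallelClass-joined i j with abscissa i ≟ abscissa j
  ... | yes x≡ = Fin.zero , x≡
  ... | no x≢ = let a , a<q , h = collinear-slope pr (X i) (C i) (X j) (C j) (x≢ ∘ abscissa-≡) in
    Fin.suc (fromℕ< a<q) ,
    subst (λ b → intercept b i % q ≡ intercept b j % q) (sym (toℕ-fromℕ< a<q)) (aligned⁻ a i j h)

  -- Vieta: a line of slope - a meets the parabola where a monic quadratic with linear coefficient a
  -- vanishes, and the two abscissas are its distinct roots.
  sum-of-roots : ∀ a {i j} → height i ≡ height j → i ≢ j → Aligned a i j → + q ∣ℤ X i ℤ.+ X j ℤ.+ + a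
  sum-of-roots a {i} {j} c≡ i≢j h =
    [ (λ d → ⊥-elim (i≢j (coordinates-injective (abscissa-≡ d) c≡))) , id ]′
    (collinear-parabola pr (+ a) (X i) (X j) (C i)
      (subst (λ c → Collinear q (+ a) (X i) (C i) (X j) (+ c)) (sym c≡) h))

  -- A vertical line meets a parabola once. On any other line x_i + x_j and x_i + x_k are both
  -- congruent to - a, so j and k have the same abscissa.
  no-three-on-parabola : ∀ a {i j k} → parallelClass a i ≡ parallelClass a j → parallelClass a i ≡ parallelClass a k →
    height i ≡ height j → height i ≡ height k → i ≢ j → i ≢ k → j ≢ k → ⊥
  no-three-on-parabola Fin.zero    e _ c≡ _ i≢j _ _ = i≢j (coordinates-injective e c≡)
  no-three-on-parabola (Fin.suc a) {i} {j} {k} e e′ c≡ c≡′ i≢j i≢k j≢k = j≢k (coordinates-injective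
    (abscissa-≡ (subst (+ q ∣ℤ_) (cancel (X i) (X j) (X k) (+ toℕ a))
      (Signed.∣m∣n⇒∣m-n (sum-of-roots (toℕ a) c≡ i≢j (aligned⁺ (toℕ a) i j e))
                 (sum-of-roots (toℕ a) c≡′ i≢k (aligned⁺ (toℕ a) i k e′)))))
    (trans (sym c≡) c≡′))
    where
    cancel : ∀ x y z a → (x ℤ.+ y ℤ.+ a) ℤ.- (x ℤ.+ z ℤ.+ a) ≡ y ℤ.- z
    cancel = ℤ.solve-∀

  parallelClass-small : ∀ a b → length (filter (λ i → parallelClass a i ≟ b) (allFin n)) ≤ suc (n / q) * 2
  parallelClass-small a b = length-fibres-≤ height (suc (n / q)) (Unique.filter⁺ on? (Unique.allFin⁺ n))
    (λ {i} _ → s≤s (height-≤ i))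
    (λ i∈ j∈ k∈ → no-three-on-parabola a (trans (on i∈) (sym (on j∈))) (trans (on i∈) (sym (on k∈))))
    where
    on? = λ i → parallelClass a i ≟ b
    on : ∀ {i} → i ∈ filter on? (allFin n) → parallelClass a i ≡ b
    on = proj₂ ∘ ∈-filter⁻ on? {xs = allFin n}

-- Counting cliques

-- The left side is the q² + q lines plus 2mK pairs for K = 2(k + 1), where k stands for `n / q`.
-- The 10 is 1 + 1 + 4 + 4, from the terms q², q, 4m and 4mk.
partition-size : ∀ {m q k} → m < q * q → 0 < q → m * k < q * q →
                 suc q * q + m * (suc k * 2 + suc k * 2) ≤ 10 * (q * q)
partition-size {m} {q} {k} m<q² 0<q mk<q² = begin
  suc q * q + m * (suc k * 2 + suc k * 2)        ≡⟨ regroup₁ q m k ⟩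
  q * q + q + 4 * m + 4 * (m * k)                ≤⟨ +-mono-≤ (+-mono-≤ (+-monoʳ-≤ (q * q) (m≤m*n q q {{>-nonZero 0<q}}))
                                                                        (*-monoʳ-≤ 4 (<⇒≤ m<q²)))
                                                              (*-monoʳ-≤ 4 (<⇒≤ mk<q²)) ⟩
  q * q + q * q + 4 * (q * q) + 4 * (q * q)      ≡⟨ regroup₂ (q * q) ⟩
  10 * (q * q)                                   ∎
  where
  open ≤-Reasoning
  regroup₁ : ∀ q m k → suc q * q + m * (suc k * 2 + suc k * 2) ≡ q * q + q + 4 * m + 4 * (m * k)
  regroup₁ = solve-∀
  regroup₂ : ∀ z → z + z + 4 * z + 4 * z ≡ 10 * z
  regroup₂ = solve-∀

partition-via-prime : ∀ {n q} (F : Graph n) → Prime q → n ≤ edgeCount F * edgeCount F → edgeCount F * n < q ^ 3 →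
  Σ (List (Subset n)) (λ Cs → IsCliquePartition (complement F) Cs × length Cs ≤ 10 * (q * q))
partition-via-prime {n} {q} F pr n≤m² mn<q³ =
  cliques , cliques-partition , ≤-trans length-cliques (partition-size m<q² (>-nonZero⁻¹ q) mk<q²)
  where
  m = edgeCount F
  instance
    q≢0 : NonZero q
    q≢0 = prime⇒nonZero pr
  square-< : m * n * (m * n) < (q * q) ^ 3
  square-< = subst (m * n * (m * n) <_) (regroup q) (*-mono-< mn<q³ mn<q³)
    where
    regroup : ∀ q → q * (q * (q * 1)) * (q * (q * (q * 1))) ≡ q * q * (q * q * (q * q * 1))
    regroup = solve-∀
  -- Here m ≥ √n is used: n³ ≤ m²n² < q⁶.
  n<q² : n < q * q
  n<q² = ^3-cancel-< (≤-<-trans n³≤ square-<)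
    where
    regroup₁ : ∀ n → n * (n * (n * 1)) ≡ n * (n * n)
    regroup₁ = solve-∀
    regroup₂ : ∀ m n → m * m * (n * n) ≡ m * n * (m * n)
    regroup₂ = solve-∀
    n³≤ : n ^ 3 ≤ m * n * (m * n)
    n³≤ = subst₂ _≤_ (sym (regroup₁ n)) (regroup₂ m n) (*-monoˡ-≤ (n * n) n≤m²)
  -- Similarly m³ ≤ m²n² < q⁶, now from m ≤ n².
  m<q² : m < q * q
  m<q² = ^3-cancel-< (≤-<-trans m³≤ square-<)
    where
    regroup₁ : ∀ m → m * (m * (m * 1)) ≡ m * m * m
    regroup₁ = solve-∀
    regroup₂ : ∀ m n → m * m * (n * n) ≡ m * n * (m * n)
    regroup₂ = solve-∀
    m³≤ : m ^ 3 ≤ m * n * (m * n)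
    m³≤ = subst₂ _≤_ (sym (regroup₁ m)) (regroup₂ m n) (*-monoʳ-≤ (m * m) (edgeCount-≤ {G = F}))
  mk<q² : m * (n / q) < q * q
  mk<q² = *-cancelʳ-< q (m * (n / q)) (q * q) (begin-strict
    m * (n / q) * q   ≡⟨ *-assoc m (n / q) q ⟩
    m * (n / q * q)   ≤⟨ *-monoʳ-≤ m (m/n*n≤m n q) ⟩
    m * n             <⟨ mn<q³ ⟩
    q ^ 3             ≡⟨ regroup q ⟩
    q * q * q         ∎)
    where
    open ≤-Reasoning
    regroup : ∀ q → q * (q * (q * 1)) ≡ q * q * q
    regroup = solve-∀
  open Parabolas {q} {n} pr n<q²
  open LinearSpace parallelClass parallelClass-< (λ {i} {j} _ → parallelClass-joined i j)
                   parallelClass-unique parallelClass-small F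

-- To stay within ℕ, the bound is cubed and m ≥ √n is squared; the constant is accordingly the cube
-- of the one in the O-estimate. Any partition of this size bounds the minimum.
theorem6p2 : ∃[ C ] ((n : ℕ) (F : Graph n) → n ≤ edgeCount F * edgeCount F →
    Σ (List (Subset n)) (λ Cs → IsCliquePartition (complement F) Cs ×
    length Cs ^ 3 ≤ C * (edgeCount F * n) ^ 2))
-- The cube of 10q² is 10³ (q³)², and q³ ≤ `ratio` · mn.
theorem6p2 = 10 ^ 3 * ratio ^ 2 , bound
  where
  bound : ∀ n (F : Graph n) → n ≤ edgeCount F * edgeCount F →
    Σ (List (Subset n)) (λ Cs → IsCliquePartition (complement F) Cs ×
      length Cs ^ 3 ≤ 10 ^ 3 * ratio ^ 2 * (edgeCount F * n) ^ 2)
  -- The choice of a prime requires mn > 0: the empty partition serves n = 0, and m = 0 contradicts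
  -- 0 < n ≤ m².
  bound zero F _ = [] , ([] , λ ()) , z≤n
  bound n@(suc _) F n≤m² with edgeCount F in m≡
  ... | zero = ⊥-elim (<⇒≱ z<s n≤m²)
  ... | m@(suc _) =
    let q , pr , mn<q³ , q³≤ = prime-with-cube-near (m * n) z<s
        Cs , partition , size = partition-via-prime F pr
          (subst (λ k → n ≤ k * k) (sym m≡) n≤m²)
          (subst (λ k → k * n < q ^ 3) (sym m≡) mn<q³)
    in Cs , partition , (begin
      length Cs ^ 3                     ≤⟨ ^-monoˡ-≤ 3 size ⟩
      (10 * (q * q)) ^ 3                ≡⟨ ^3-distrib-* 10 (q * q) ⟩
      10 ^ 3 * (q * q) ^ 3              ≡⟨ cong (10 ^ 3 *_) (regroup q) ⟩
      10 ^ 3 * (q ^ 3) ^ 2              ≤⟨ *-monoʳ-≤ (10 ^ 3) (^-monoˡ-≤ 2 q³≤) ⟩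
      10 ^ 3 * (ratio * (m * n)) ^ 2    ≡⟨ square (10 ^ 3) ratio (m * n) ⟩
      10 ^ 3 * ratio ^ 2 * (m * n) ^ 2  ∎)
    where
    open ≤-Reasoning
    regroup : ∀ q → q * q * (q * q * (q * q * 1)) ≡ q * (q * (q * 1)) * (q * (q * (q * 1)) * 1)
    regroup = solve-∀
    square : ∀ a r x → a * (r * x * (r * x * 1)) ≡ a * (r * (r * 1)) * (x * (x * 1))
    square = solve-∀
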